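{- Let $k$ be an integer with $k \ge 2$. There exists a computable integer $N_{0} = N_{0}(k)$ such that for every integer $n \ge N_{0}$ there are infinitely many polynomials $f(x) \in \mathbb{Z}[x]$ of degree $n$ with the following property: if $g(x) \in \mathbb{Z}[x]$ is $k$-free, then $L(f-g) \ge 2$.
   Context: For $h(x)=\sum_{j} c_j x^j \in \mathbb{Z}[x]$, the length is $L(h) = \sum_j |c_j|$. A polynomial in $\mathbb{Z}[x]$ is called $k$-free if it is not divisible by the $k$-th power of a non-constant polynomial irreducible over $\mathbb{Q}$ (for $k=2$ this is the notion of squarefree). -}

module Defs where

open import Data.Nat as ℕ using (ℕ; zero; suc; _≤_; _<_)
open import Data.Integer as ℤ using (ℤ; ∣_∣)
open import Data.Rational as ℚ using (ℚ; 0ℚ)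
open import Data.List using (List; []; _∷_; map; foldr)
open import Data.Product using (Σ; _×_; ∃)
open import Data.Sum using (_⊎_)
open import Relation.Nullary using (¬_)
open import Relation.Binary.PropositionalEquality using (_≡_; _≢_)

-- Polynomials are coefficient lists, lowest degree first.
-- Trailing zeros are allowed; equality of polynomials is coefficientwise.

PolyZ : Set
PolyZ = List ℤ

coeffZ : PolyZ → ℕ → ℤ
coeffZ []       _       = ℤ.0ℤ
coeffZ (c ∷ _)  zero    = c
coeffZ (_ ∷ cs) (suc i) = coeffZ cs i

_≈Z_ : PolyZ → PolyZ → Set
p ≈Z q = ∀ i → coeffZ p i ≡ coeffZ q i

HasDegree : PolyZ → ℕ → Set
HasDegree f n = coeffZ f n ≢ ℤ.0ℤ × (∀ i → n < i → coeffZ f i ≡ ℤ.0ℤ)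

subZ : PolyZ → PolyZ → PolyZ
subZ []       q        = map ℤ.-_ q
subZ (a ∷ p)  []       = a ∷ p
subZ (a ∷ p)  (b ∷ q)  = (a ℤ.- b) ∷ subZ p q

L : PolyZ → ℕ
L = foldr (λ c s → ∣ c ∣ ℕ.+ s) 0

PolyQ : Set
PolyQ = List ℚ

coeffQ : PolyQ → ℕ → ℚ
coeffQ []       _       = 0ℚ
coeffQ (c ∷ _)  zero    = c
coeffQ (_ ∷ cs) (suc i) = coeffQ cs i

_≈Q_ : PolyQ → PolyQ → Set
p ≈Q q = ∀ i → coeffQ p i ≡ coeffQ q i

addQ : PolyQ → PolyQ → PolyQ
addQ []       q        = q
addQ (a ∷ p)  []       = a ∷ p
addQ (a ∷ p)  (b ∷ q)  = (a ℚ.+ b) ∷ addQ p q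

mulQ : PolyQ → PolyQ → PolyQ
mulQ []       q = []
mulQ (a ∷ p)  q = addQ (map (a ℚ.*_) q) (0ℚ ∷ mulQ p q)

powQ : PolyQ → ℕ → PolyQ
powQ p zero    = ℚ.1ℚ ∷ []
powQ p (suc k) = mulQ p (powQ p k)

DividesQ : PolyQ → PolyQ → Set
DividesQ d h = Σ PolyQ λ q → mulQ d q ≈Q h

IsConstantQ : PolyQ → Set
IsConstantQ p = ∀ i → 0 < i → coeffQ p i ≡ 0ℚ

-- irreducible over ℚ: non-constant, and in any factorisation one factor is
-- constant (i.e. a unit, since the product is nonzero)
IrreducibleQ : PolyQ → Set
IrreducibleQ p = ¬ IsConstantQ p
               × (∀ a b → mulQ a b ≈Q p → IsConstantQ a ⊎ IsConstantQ b)

toQ : PolyZ → PolyQ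
toQ = map (λ c → c ℚ./ 1)

KFree : ℕ → PolyZ → Set
KFree k g = ¬ (Σ PolyQ λ p → IrreducibleQ p × DividesQ (powQ p k) (toQ g))

-- The power x^k divides f, hence also f ± x^j for every j ≥ k, so only the
-- 2k polynomials f ± x^j with j < k need further k-th power divisors.  These are
-- imposed one at a time by Chinese remaindering: if m collects the bases used so
-- far, starting with m = x, then m^k and (1 - m)^k are comaximal already over ℤ,
-- by an explicit identity, so f stays integral, and m is replaced by (1 - m) m.
-- Adding multiples of x^s m^k preserves all these divisibilities; it gives every
-- sufficiently large degree, and infinitely many polynomials in each.

module Submission where

open import Defs
open import Data.Nat using (ℕ; _≤_)
open import Data.Product using (Σ; _×_)
open import Relation.Binary.PropositionalEquality using (_≡_)

open import Algebra using (CommutativeRing)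
import Algebra.Properties.CommutativeSemigroup as CommutativeSemigroupProperties
import Algebra.Properties.CommutativeSemigroup.Divisibility as CommutativeSemigroupDivisibility
import Algebra.Properties.CommutativeSemiring.Exp as Exp
import Algebra.Properties.Ring as RingProperties
import Algebra.Properties.Semiring.Divisibility as SemiringDivisibility
open import Data.Integer as ℤ using (ℤ)
import Data.Integer.Properties as ℤ
open import Data.List using (List; []; _∷_; map; length)
open import Data.List.Relation.Unary.All as All using (All; []; _∷_)
open import Data.Nat as ℕ using (zero; suc; _<_; z≤n; s≤s)
open import Data.Nat.Induction using (<-rec)
import Data.Nat.Properties as ℕ
open import Data.Product using (∃; ∃-syntax; _,_; proj₁; proj₂)
open import Data.Rational as ℚ using (ℚ; 0ℚ; 1ℚ)
import Data.Rational.Properties as ℚ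
import Data.Rational.Unnormalised as ℚᵘ
import Data.Rational.Unnormalised.Properties as ℚᵘ
open import Data.Sum using (_⊎_; inj₁; inj₂)
open import Level using (0ℓ)
open import Relation.Binary using (IsEquivalence; Setoid; tri<; tri≈; tri>)
open import Relation.Binary.PropositionalEquality
  using (_≢_; refl; sym; trans; cong; cong₂; subst; module ≡-Reasoning)
import Relation.Binary.Reasoning.Setoid as SetoidReasoning
open import Relation.Nullary using (¬_; yes; no; contradiction)

-- Divisibility and Chinese remaindering in a commutative ring.

module DivisibilityInRing {c ℓ} (R : CommutativeRing c ℓ) where
  open CommutativeRing R hiding (refl) renaming (trans to ≈-trans; sym to ≈-sym)
  open Exp commutativeSemiring using (_^_; ^-congˡ; ^-distrib-*) public
  open SemiringDivisibility semiring public using (_∣0; ∣ʳ-refl)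
  open CommutativeSemigroupDivisibility *-commutativeSemigroup public
    using (_∣_; _,_; ∣ʳ-trans; ∣ʳ-respʳ-≈; ∣ʳ-respˡ-≈; x∣xy; ∙-cong-∣; x∣ʳy⇒x∣ʳzy)
  open RingProperties ring using (x[y-z]≈xy-xz; -‿involutive; -‿distribˡ-*)
  open SetoidReasoning setoid

  ∣-+ : ∀ {x y z} → x ∣ y → x ∣ z → x ∣ y + z
  ∣-+ {x} (a , ax≈y) (b , bx≈z) = a + b , ≈-trans (distribʳ x a b) (+-cong ax≈y bx≈z)

  ^-mono-∣ : ∀ {x y} n → x ∣ y → x ^ n ∣ y ^ n
  ^-mono-∣ {x} n (a , ax≈y) =
    a ^ n , ≈-trans (≈-sym (^-distrib-* a x n)) (^-congˡ n ax≈y)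

  x-y+y-z≈x-z : ∀ x y z → (x - y) + (y - z) ≈ x - z
  x-y+y-z≈x-z x y z = begin
    (x - y) + (y - z)      ≈⟨ +-assoc x (- y) (y - z) ⟩
    x + (- y + (y - z))    ≈⟨ +-congˡ (+-assoc (- y) y (- z)) ⟨
    x + ((- y + y) - z)    ≈⟨ +-congˡ (+-congʳ (-‿inverseˡ y)) ⟩
    x + (0# - z)           ≈⟨ +-congˡ (+-identityˡ (- z)) ⟩
    x - z                  ∎

  x-y+y≈x : ∀ x y → (x - y) + y ≈ x
  x-y+y≈x x y = begin
    (x - y) + y    ≈⟨ +-assoc x (- y) y ⟩
    x + (- y + y)  ≈⟨ +-congˡ (-‿inverseˡ y) ⟩
    x + 0#         ≈⟨ +-identityʳ x ⟩
    x              ∎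

  x[1-y]≈x-xy : ∀ x y → x * (1# - y) ≈ x - x * y
  x[1-y]≈x-xy x y = ≈-trans (x[y-z]≈xy-xz x 1# y) (+-congʳ (*-identityʳ x))

  x-[x-y]≈y : ∀ x y → x - (x - y) ≈ y
  x-[x-y]≈y x y = begin
    x - (x - y)              ≈⟨ x-y+y≈x (x - (x - y)) y ⟨
    (x - (x - y)) - y + y    ≈⟨ +-congʳ (+-assoc x (- (x - y)) (- y)) ⟩
    x + (- (x - y) - y) + y  ≈⟨ +-congʳ (+-congˡ (+-comm (- (x - y)) (- y))) ⟩
    x + (- y - (x - y)) + y  ≈⟨ +-congʳ (+-assoc x (- y) (- (x - y))) ⟨
    (x - y) - (x - y) + y    ≈⟨ +-congʳ (-‿inverseʳ (x - y)) ⟩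
    0# + y                   ≈⟨ +-identityˡ y ⟩
    y                        ∎

  -- Induction through `1 - x^(n+1) = (1 - x) + x (1 - x^n)`. It is applied twice below: at `m`,
  -- where it relates `1 - m` to `1 - m^k`, and at `1 - m^k`, where it relates `m^k` to
  -- `1 - (1 - m^k)^k`.
  1-x∣1-x^n : ∀ x n → 1# - x ∣ 1# - x ^ n
  1-x∣1-x^n x zero    = ∣ʳ-respʳ-≈ (≈-sym (-‿inverseʳ 1#)) (_ ∣0)
  1-x∣1-x^n x (suc n) = ∣ʳ-respʳ-≈
    (≈-trans (+-congˡ (x[1-y]≈x-xy x (x ^ n))) (x-y+y-z≈x-z 1# x (x * x ^ n)))
    (∣-+ (1# , *-identityˡ _) (x∣ʳy⇒x∣ʳzy x (1-x∣1-x^n x n)))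

  -- Chinese remaindering for the comaximal moduli m ^ k and (1# - m) ^ k: the
  -- factor (1# - m ^ k) ^ k is 1 modulo the first and 0 modulo the second.
  adjust : ℕ → Carrier → Carrier → Carrier → Carrier
  adjust k m f t = (f + t) * (1# - m ^ k) ^ k - t

  -- Adding `t` back cancels the final subtraction and leaves a multiple of `(1 - m^k)^k`, whose
  -- base is a multiple of `1 - m`.
  adjust-new : ∀ k m f t → (1# - m) ^ k ∣ adjust k m f t + t
  adjust-new k m f t = ∣ʳ-respʳ-≈ (≈-sym (x-y+y≈x _ t))
    (x∣ʳy⇒x∣ʳzy (f + t) (^-mono-∣ k (1-x∣1-x^n m k)))

  -- The adjustment changes `f` by `- (f + t) (1 - v)`, a multiple of `m^k`. In use `x` is the
  -- `k`-th power of a divisor of `m`, so every earlier divisibility survives.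
  adjust-old : ∀ k m f t {x s} → x ∣ m ^ k → x ∣ f + s → x ∣ adjust k m f t + s
  adjust-old k m f t {x} {s} x∣mᵏ x∣f+s = ∣ʳ-respʳ-≈ (≈-sym change)
    (∣-+ (x∣ʳy⇒x∣ʳzy (- e) (∣ʳ-trans x∣mᵏ mᵏ∣1-v)) x∣f+s)
    where
    e = f + t
    v = (1# - m ^ k) ^ k

    mᵏ∣1-v : m ^ k ∣ 1# - v
    -- `m^k` is itself of the form `1 - y`, with `y = 1 - m^k`.
    mᵏ∣1-v = ∣ʳ-respˡ-≈ (x-[x-y]≈y 1# (m ^ k)) (1-x∣1-x^n (1# - m ^ k) k)

    e-t+s≈f+s : (e - t) + s ≈ f + s
    e-t+s≈f+s = +-congʳ (begin
      (f + t) - t  ≈⟨ +-assoc f t (- t) ⟩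
      f + (t - t)  ≈⟨ +-congˡ (-‿inverseʳ t) ⟩
      f + 0#       ≈⟨ +-identityʳ f ⟩
      f            ∎)

    ev-e≈-e[1-v] : e * v - e ≈ - e * (1# - v)
    ev-e≈-e[1-v] = begin
      e * v - e                ≈⟨ +-comm (e * v) (- e) ⟩
      - e + e * v              ≈⟨ +-congˡ (-‿involutive (e * v)) ⟨
      - e - - (e * v)          ≈⟨ +-congˡ (-‿cong (-‿distribˡ-* e v)) ⟩
      - e - - e * v            ≈⟨ x[1-y]≈x-xy (- e) v ⟨
      - e * (1# - v)           ∎

    change : adjust k m f t + s ≈ - e * (1# - v) + (f + s)
    change = begin
      (e * v - t) + s                ≈⟨ +-congʳ (x-y+y-z≈x-z (e * v) e t) ⟨
      ((e * v - e) + (e - t)) + s    ≈⟨ +-assoc (e * v - e) (e - t) s ⟩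
      (e * v - e) + ((e - t) + s)    ≈⟨ +-cong ev-e≈-e[1-v] e-t+s≈f+s ⟩
      - e * (1# - v) + (f + s)       ∎

-- The commutative ring of rational polynomials.

open CommutativeSemigroupProperties
  (CommutativeRing.+-commutativeSemigroup ℚ.+-*-commutativeRing)
  using (interchange)

-- Unlike _≈Q_, which unfolds to a function type, the wrapped equality lets
-- unification recover the two polynomials.
infix 4 _≋_
record _≋_ (p q : PolyQ) : Set where
  constructor pointwise
  field at : p ≈Q q
open _≋_

≋-isEquivalence : IsEquivalence _≋_
≋-isEquivalence = record
  { refl  = pointwise λ _ → refl
  ; sym   = λ p≋q → pointwise λ i → sym (at p≋q i)
  ; trans = λ p≋q q≋r → pointwise λ i → trans (at p≋q i) (at q≋r i)
  }

open IsEquivalence ≋-isEquivalence using ()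
  renaming (refl to ≋-refl; sym to ≋-sym; trans to ≋-trans)

≋-setoid : Setoid 0ℓ 0ℓ
≋-setoid = record { isEquivalence = ≋-isEquivalence }

scaleQ : ℚ → PolyQ → PolyQ
scaleQ a = map (a ℚ.*_)

negQ : PolyQ → PolyQ
negQ = map (ℚ.-_)

coeff-add : ∀ p q i → coeffQ (addQ p q) i ≡ coeffQ p i ℚ.+ coeffQ q i
coeff-add []      q       i       = sym (ℚ.+-identityˡ _)
coeff-add (a ∷ p) []      i       = sym (ℚ.+-identityʳ _)
coeff-add (a ∷ p) (b ∷ q) zero    = refl
coeff-add (a ∷ p) (b ∷ q) (suc i) = coeff-add p q i

coeff-scale : ∀ a p i → coeffQ (scaleQ a p) i ≡ a ℚ.* coeffQ p i
coeff-scale a []      i       = sym (ℚ.*-zeroʳ a)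
coeff-scale a (b ∷ p) zero    = refl
coeff-scale a (b ∷ p) (suc i) = coeff-scale a p i

coeff-neg : ∀ p i → coeffQ (negQ p) i ≡ ℚ.- coeffQ p i
coeff-neg []      i       = refl
coeff-neg (b ∷ p) zero    = refl
coeff-neg (b ∷ p) (suc i) = coeff-neg p i

add-cong : ∀ {p q r s} → p ≋ q → r ≋ s → addQ p r ≋ addQ q s
add-cong {p} {q} {r} {s} p≋q r≋s = pointwise λ i → begin
  coeffQ (addQ p r) i        ≡⟨ coeff-add p r i ⟩
  coeffQ p i ℚ.+ coeffQ r i  ≡⟨ cong₂ ℚ._+_ (at p≋q i) (at r≋s i) ⟩
  coeffQ q i ℚ.+ coeffQ s i  ≡⟨ coeff-add q s i ⟨
  coeffQ (addQ q s) i        ∎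
  where open ≡-Reasoning

add-assoc : ∀ p q r → addQ (addQ p q) r ≋ addQ p (addQ q r)
add-assoc p q r = pointwise λ i → begin
  coeffQ (addQ (addQ p q) r) i                  ≡⟨ coeff-add (addQ p q) r i ⟩
  coeffQ (addQ p q) i ℚ.+ coeffQ r i            ≡⟨ cong (ℚ._+ coeffQ r i) (coeff-add p q i) ⟩
  (coeffQ p i ℚ.+ coeffQ q i) ℚ.+ coeffQ r i    ≡⟨ ℚ.+-assoc (coeffQ p i) _ _ ⟩
  coeffQ p i ℚ.+ (coeffQ q i ℚ.+ coeffQ r i)    ≡⟨ cong (coeffQ p i ℚ.+_) (coeff-add q r i) ⟨
  coeffQ p i ℚ.+ coeffQ (addQ q r) i            ≡⟨ coeff-add p (addQ q r) i ⟨
  coeffQ (addQ p (addQ q r)) i                  ∎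
  where open ≡-Reasoning

add-comm : ∀ p q → addQ p q ≋ addQ q p
add-comm p q = pointwise λ i →
  trans (coeff-add p q i) (trans (ℚ.+-comm (coeffQ p i) (coeffQ q i)) (sym (coeff-add q p i)))

add-identityʳ : ∀ p → addQ p [] ≋ p
add-identityʳ p = add-comm p []

add-inverseˡ : ∀ p → addQ (negQ p) p ≋ []
add-inverseˡ p = pointwise λ i → begin
  coeffQ (addQ (negQ p) p) i       ≡⟨ coeff-add (negQ p) p i ⟩
  coeffQ (negQ p) i ℚ.+ coeffQ p i  ≡⟨ cong (ℚ._+ coeffQ p i) (coeff-neg p i) ⟩
  ℚ.- coeffQ p i ℚ.+ coeffQ p i     ≡⟨ ℚ.+-inverseˡ (coeffQ p i) ⟩
  0ℚ                                ∎
  where open ≡-Reasoning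

neg-cong : ∀ {p q} → p ≋ q → negQ p ≋ negQ q
neg-cong {p} {q} p≋q = pointwise λ i →
  trans (coeff-neg p i) (trans (cong (ℚ.-_) (at p≋q i)) (sym (coeff-neg q i)))

scale-cong : ∀ a {p q} → p ≋ q → scaleQ a p ≋ scaleQ a q
scale-cong a {p} {q} p≋q = pointwise λ i →
  trans (coeff-scale a p i) (trans (cong (a ℚ.*_) (at p≋q i)) (sym (coeff-scale a q i)))

scale-add : ∀ a p q → scaleQ a (addQ p q) ≋ addQ (scaleQ a p) (scaleQ a q)
scale-add a p q = pointwise λ i → begin
  coeffQ (scaleQ a (addQ p q)) i                  ≡⟨ coeff-scale a (addQ p q) i ⟩
  a ℚ.* coeffQ (addQ p q) i                       ≡⟨ cong (a ℚ.*_) (coeff-add p q i) ⟩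
  a ℚ.* (coeffQ p i ℚ.+ coeffQ q i)               ≡⟨ ℚ.*-distribˡ-+ a (coeffQ p i) _ ⟩
  a ℚ.* coeffQ p i ℚ.+ a ℚ.* coeffQ q i           ≡⟨ cong₂ ℚ._+_ (coeff-scale a p i) (coeff-scale a q i) ⟨
  coeffQ (scaleQ a p) i ℚ.+ coeffQ (scaleQ a q) i ≡⟨ coeff-add (scaleQ a p) (scaleQ a q) i ⟨
  coeffQ (addQ (scaleQ a p) (scaleQ a q)) i       ∎
  where open ≡-Reasoning

scale-scale : ∀ a b p → scaleQ (a ℚ.* b) p ≋ scaleQ a (scaleQ b p)
scale-scale a b p = pointwise λ i → begin
  coeffQ (scaleQ (a ℚ.* b) p) i      ≡⟨ coeff-scale (a ℚ.* b) p i ⟩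
  (a ℚ.* b) ℚ.* coeffQ p i           ≡⟨ ℚ.*-assoc a b (coeffQ p i) ⟩
  a ℚ.* (b ℚ.* coeffQ p i)           ≡⟨ cong (a ℚ.*_) (coeff-scale b p i) ⟨
  a ℚ.* coeffQ (scaleQ b p) i        ≡⟨ coeff-scale a (scaleQ b p) i ⟨
  coeffQ (scaleQ a (scaleQ b p)) i   ∎
  where open ≡-Reasoning

scale-0 : ∀ p → scaleQ 0ℚ p ≋ []
scale-0 p = pointwise λ i → trans (coeff-scale 0ℚ p i) (ℚ.*-zeroˡ (coeffQ p i))

scale-1 : ∀ p → scaleQ 1ℚ p ≋ p
scale-1 p = pointwise λ i → trans (coeff-scale 1ℚ p i) (ℚ.*-identityˡ (coeffQ p i))

∷-cong : ∀ {a b p q} → a ≡ b → p ≋ q → (a ∷ p) ≋ (b ∷ q)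
∷-cong a≡b p≋q = pointwise λ where
  zero    → a≡b
  (suc i) → at p≋q i

0∷[]≋[] : (0ℚ ∷ []) ≋ []
0∷[]≋[] = pointwise λ where
  zero    → refl
  (suc i) → refl

0∷-add : ∀ p q → (0ℚ ∷ addQ p q) ≋ addQ (0ℚ ∷ p) (0ℚ ∷ q)
0∷-add p q = ∷-cong (sym (ℚ.+-identityˡ 0ℚ)) ≋-refl

add-interchange : ∀ p q r s →
  addQ (addQ p q) (addQ r s) ≋ addQ (addQ p r) (addQ q s)
add-interchange p q r s = pointwise λ i → begin
  coeffQ (addQ (addQ p q) (addQ r s)) i
    ≡⟨ coeff-add² p q r s i ⟩
  (coeffQ p i ℚ.+ coeffQ q i) ℚ.+ (coeffQ r i ℚ.+ coeffQ s i)
    ≡⟨ interchange (coeffQ p i) (coeffQ q i) (coeffQ r i) (coeffQ s i) ⟩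
  (coeffQ p i ℚ.+ coeffQ r i) ℚ.+ (coeffQ q i ℚ.+ coeffQ s i)
    ≡⟨ coeff-add² p r q s i ⟨
  coeffQ (addQ (addQ p r) (addQ q s)) i ∎
  where
  open ≡-Reasoning
  coeff-add² : ∀ p q r s i → coeffQ (addQ (addQ p q) (addQ r s)) i
    ≡ (coeffQ p i ℚ.+ coeffQ q i) ℚ.+ (coeffQ r i ℚ.+ coeffQ s i)
  coeff-add² p q r s i = trans (coeff-add (addQ p q) (addQ r s) i)
    (cong₂ ℚ._+_ (coeff-add p q i) (coeff-add r s i))

module ≋-Reasoning = SetoidReasoning ≋-setoid

mul-congˡ : ∀ p {q r} → q ≋ r → mulQ p q ≋ mulQ p r
mul-congˡ []      q≋r = ≋-refl
mul-congˡ (a ∷ p) q≋r = add-cong (scale-cong a q≋r) (∷-cong refl (mul-congˡ p q≋r))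

mul-zeroʳ : ∀ p → mulQ p [] ≋ []
mul-zeroʳ []      = ≋-refl
mul-zeroʳ (a ∷ p) = ≋-trans (∷-cong refl (mul-zeroʳ p)) 0∷[]≋[]

-- `mulQ` recurses on its left factor; this mirror image of its defining equation lets commutativity
-- be proved by induction.
mul-∷ʳ : ∀ p b q → mulQ p (b ∷ q) ≋ addQ (scaleQ b p) (0ℚ ∷ mulQ p q)
mul-∷ʳ []      b q = ≋-sym 0∷[]≋[]
mul-∷ʳ (a ∷ p) b q = ∷-cong (cong (ℚ._+ 0ℚ) (ℚ.*-comm a b)) (begin
  addQ (scaleQ a q) (mulQ p (b ∷ q))
    ≈⟨ add-cong ≋-refl (mul-∷ʳ p b q) ⟩
  addQ (scaleQ a q) (addQ (scaleQ b p) (0ℚ ∷ mulQ p q))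
    ≈⟨ add-assoc (scaleQ a q) _ _ ⟨
  addQ (addQ (scaleQ a q) (scaleQ b p)) (0ℚ ∷ mulQ p q)
    ≈⟨ add-cong (add-comm (scaleQ a q) _) ≋-refl ⟩
  addQ (addQ (scaleQ b p) (scaleQ a q)) (0ℚ ∷ mulQ p q)
    ≈⟨ add-assoc (scaleQ b p) _ _ ⟩
  addQ (scaleQ b p) (mulQ (a ∷ p) q) ∎)
  where open ≋-Reasoning

mul-comm : ∀ p q → mulQ p q ≋ mulQ q p
mul-comm []      q = ≋-sym (mul-zeroʳ q)
mul-comm (a ∷ p) q = begin
  addQ (scaleQ a q) (0ℚ ∷ mulQ p q)  ≈⟨ add-cong ≋-refl (∷-cong refl (mul-comm p q)) ⟩
  addQ (scaleQ a q) (0ℚ ∷ mulQ q p)  ≈⟨ mul-∷ʳ q a p ⟨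
  mulQ q (a ∷ p)                     ∎
  where open ≋-Reasoning

-- Equal left factors may be lists of different lengths, which the recursion of `mulQ` does not see;
-- commutativity moves them to the right, where congruence is structural.
mul-cong : ∀ {p q r s} → p ≋ q → r ≋ s → mulQ p r ≋ mulQ q s
mul-cong {p} {q} {r} {s} p≋q r≋s = begin
  mulQ p r  ≈⟨ mul-congˡ p r≋s ⟩
  mulQ p s  ≈⟨ mul-comm p s ⟩
  mulQ s p  ≈⟨ mul-congˡ s p≋q ⟩
  mulQ s q  ≈⟨ mul-comm s q ⟩
  mulQ q s  ∎
  where open ≋-Reasoning

mul-distribˡ : ∀ p q r → mulQ p (addQ q r) ≋ addQ (mulQ p q) (mulQ p r)
mul-distribˡ []      q r = ≋-refl
mul-distribˡ (a ∷ p) q r = begin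
  addQ (scaleQ a (addQ q r)) (0ℚ ∷ mulQ p (addQ q r))
    ≈⟨ add-cong (scale-add a q r)
         (≋-trans (∷-cong refl (mul-distribˡ p q r)) (0∷-add (mulQ p q) _)) ⟩
  addQ (addQ (scaleQ a q) (scaleQ a r)) (addQ (0ℚ ∷ mulQ p q) (0ℚ ∷ mulQ p r))
    ≈⟨ add-interchange (scaleQ a q) _ _ _ ⟩
  addQ (mulQ (a ∷ p) q) (mulQ (a ∷ p) r) ∎
  where open ≋-Reasoning

mul-distribʳ : ∀ p q r → mulQ (addQ q r) p ≋ addQ (mulQ q p) (mulQ r p)
mul-distribʳ p q r = begin
  mulQ (addQ q r) p            ≈⟨ mul-comm (addQ q r) p ⟩
  mulQ p (addQ q r)            ≈⟨ mul-distribˡ p q r ⟩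
  addQ (mulQ p q) (mulQ p r)   ≈⟨ add-cong (mul-comm p q) (mul-comm p r) ⟩
  addQ (mulQ q p) (mulQ r p)   ∎
  where open ≋-Reasoning

0∷-mul : ∀ p q → mulQ (0ℚ ∷ p) q ≋ (0ℚ ∷ mulQ p q)
0∷-mul p q = add-cong (scale-0 q) ≋-refl

scale-mul : ∀ a p q → mulQ (scaleQ a p) q ≋ scaleQ a (mulQ p q)
scale-mul a []      q = ≋-refl
scale-mul a (b ∷ p) q = begin
  addQ (scaleQ (a ℚ.* b) q) (0ℚ ∷ mulQ (scaleQ a p) q)
    ≈⟨ add-cong (scale-scale a b q) (∷-cong (sym (ℚ.*-zeroʳ a)) (scale-mul a p q)) ⟩
  addQ (scaleQ a (scaleQ b q)) (scaleQ a (0ℚ ∷ mulQ p q))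
    ≈⟨ scale-add a (scaleQ b q) _ ⟨
  scaleQ a (mulQ (b ∷ p) q) ∎
  where open ≋-Reasoning

mul-assoc : ∀ p q r → mulQ (mulQ p q) r ≋ mulQ p (mulQ q r)
mul-assoc []      q r = ≋-refl
mul-assoc (a ∷ p) q r = begin
  mulQ (addQ (scaleQ a q) (0ℚ ∷ mulQ p q)) r
    ≈⟨ mul-distribʳ r (scaleQ a q) _ ⟩
  addQ (mulQ (scaleQ a q) r) (mulQ (0ℚ ∷ mulQ p q) r)
    ≈⟨ add-cong (scale-mul a q r)
         (≋-trans (0∷-mul (mulQ p q) r) (∷-cong refl (mul-assoc p q r))) ⟩
  mulQ (a ∷ p) (mulQ q r) ∎
  where open ≋-Reasoning

const-mul : ∀ a p → mulQ (a ∷ []) p ≋ scaleQ a p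
const-mul a p = ≋-trans (add-cong ≋-refl 0∷[]≋[]) (add-identityʳ _)

mul-identityˡ : ∀ p → mulQ (1ℚ ∷ []) p ≋ p
mul-identityˡ p = ≋-trans (const-mul 1ℚ p) (scale-1 p)

polyRing : CommutativeRing 0ℓ 0ℓ
polyRing = record
  { Carrier = PolyQ
  ; _≈_ = _≋_
  ; _+_ = addQ
  ; _*_ = mulQ
  ; -_ = negQ
  ; 0# = []
  ; 1# = 1ℚ ∷ []
  ; isCommutativeRing = record
    { isRing = record
      { +-isAbelianGroup = record
        { isGroup = record
          { isMonoid = record
            { isSemigroup = record
              { isMagma = record { isEquivalence = ≋-isEquivalence ; ∙-cong = add-cong }
              ; assoc = add-assoc
              }
            ; identity = (λ _ → ≋-refl) , add-identityʳ
            }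
          ; inverse = add-inverseˡ , λ p → ≋-trans (add-comm p (negQ p)) (add-inverseˡ p)
          ; ⁻¹-cong = neg-cong
          }
        ; comm = add-comm
        }
      ; *-cong = mul-cong
      ; *-assoc = mul-assoc
      ; *-identity = mul-identityˡ , λ p → ≋-trans (mul-comm p _) (mul-identityˡ p)
      ; distrib = mul-distribˡ , mul-distribʳ
      }
    ; *-comm = mul-comm
    }
  }

open CommutativeRing polyRing using (_+_; _-_; _*_; -_; 1#; *-congʳ; *-identityˡ; *-identityʳ)
open DivisibilityInRing polyRing

-- Degrees of rational polynomials.

*ℚ-cancelˡ : ∀ {a b c} → a ≢ 0ℚ → a ℚ.* b ≡ a ℚ.* c → b ≡ c
*ℚ-cancelˡ {a} {b} {c} a≢0 ab≡ac = begin
  b                        ≡⟨ a⁻¹[ax]≡x b ⟨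
  ℚ.1/ a ℚ.* (a ℚ.* b)     ≡⟨ cong (ℚ.1/ a ℚ.*_) ab≡ac ⟩
  ℚ.1/ a ℚ.* (a ℚ.* c)     ≡⟨ a⁻¹[ax]≡x c ⟩
  c                        ∎
  where
  open ≡-Reasoning
  instance
    a-nonZero : ℚ.NonZero a
    a-nonZero = ℚ.≢-nonZero a≢0
  a⁻¹[ax]≡x : ∀ x → ℚ.1/ a ℚ.* (a ℚ.* x) ≡ x
  a⁻¹[ax]≡x x = trans (sym (ℚ.*-assoc (ℚ.1/ a) a x))
    (trans (cong (ℚ._* x) (ℚ.*-inverseˡ a)) (ℚ.*-identityˡ x))

-- A relation and not a function: trailing zeros separate degree from list length, and the zero
-- polynomial has no degree.
record Degree (p : PolyQ) (n : ℕ) : Set where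
  constructor degree
  field
    lead≢0  : coeffQ p n ≢ 0ℚ
    above≡0 : ∀ i → n < i → coeffQ p i ≡ 0ℚ
open Degree

Degree-resp-≋ : ∀ {p q n} → p ≋ q → Degree p n → Degree q n
Degree-resp-≋ p≋q (degree pₙ≢0 above) = degree
  (λ qₙ≡0 → pₙ≢0 (trans (at p≋q _) qₙ≡0)) λ i n<i → trans (sym (at p≋q i)) (above i n<i)

Degree-unique : ∀ {p m n} → Degree p m → Degree p n → m ≡ n
Degree-unique {m = m} {n} (degree pₘ≢0 aboveₘ) (degree pₙ≢0 aboveₙ) with ℕ.<-cmp m n
... | tri< m<n _ _ = contradiction (aboveₘ n m<n) pₙ≢0
... | tri≈ _ m≡n _ = m≡n
... | tri> _ _ n<m = contradiction (aboveₙ m n<m) pₘ≢0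

Degree-∷ : ∀ {a p n} → Degree p n → Degree (a ∷ p) (suc n)
Degree-∷ (degree pₙ≢0 above) = degree pₙ≢0 λ { (suc i) (s≤s n<i) → above i n<i }

-- Equality in ℚ is decidable, so the last non-zero entry can be found; this makes the case split on
-- factors in `KFree⇒∤` constructive.
zero-or-degree : ∀ p → p ≋ [] ⊎ ∃ (Degree p)
zero-or-degree [] = inj₁ ≋-refl
zero-or-degree (a ∷ p) with zero-or-degree p | a ℚ.≟ 0ℚ
... | inj₂ (n , deg) | _       = inj₂ (suc n , Degree-∷ deg)
... | inj₁ p≋0       | yes a≡0 = inj₁ (≋-trans (∷-cong a≡0 p≋0) 0∷[]≋[])
... | inj₁ p≋0       | no a≢0  = inj₂ (0 , degree a≢0 λ { (suc i) _ → at p≋0 i })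

Degree-scale : ∀ {a p n} → a ≢ 0ℚ → Degree p n → Degree (scaleQ a p) n
Degree-scale {a} {p} {n} a≢0 (degree pₙ≢0 above) = degree
  (λ apₙ≡0 → pₙ≢0 (*ℚ-cancelˡ a≢0
    (trans (sym (coeff-scale a p n)) (trans apₙ≡0 (sym (ℚ.*-zeroʳ a))))))
  λ i n<i → trans (coeff-scale a p i) (trans (cong (a ℚ.*_) (above i n<i)) (ℚ.*-zeroʳ a))

coeff-add-zeroˡ : ∀ p q i → coeffQ p i ≡ 0ℚ → coeffQ (p + q) i ≡ coeffQ q i
coeff-add-zeroˡ p q i pᵢ≡0 =
  trans (coeff-add p q i) (trans (cong (ℚ._+ coeffQ q i) pᵢ≡0) (ℚ.+-identityˡ (coeffQ q i)))

Degree-addˡ : ∀ {p q n} → (∀ i → n ≤ i → coeffQ p i ≡ 0ℚ) → Degree q n → Degree (p + q) n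
Degree-addˡ {p} {q} {n} p-small (degree qₙ≢0 above) = degree
  (λ sum≡0 → qₙ≢0 (trans (sym (coeff-add-zeroˡ p q n (p-small n ℕ.≤-refl))) sum≡0))
  λ i n<i → trans (coeff-add-zeroˡ p q i (p-small i (ℕ.<⇒≤ n<i))) (above i n<i)

-- Induction on `m`. For `m = 0` the tail `p` vanishes and the product is `q` scaled by `a`.
-- Otherwise `a q` vanishes above `n`, so the leading term comes from the shifted product of `p` and
-- `q`.
Degree-* : ∀ {p q m n} → Degree p m → Degree q n → Degree (p * q) (m ℕ.+ n)
Degree-* {[]}    {m = m}     (degree pₘ≢0 _) _ = contradiction refl pₘ≢0
Degree-* {a ∷ p} {q} {zero}  (degree a≢0 above) deg-q =
  Degree-resp-≋ (≋-sym aq≋) (Degree-scale a≢0 deg-q)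
  where
  aq≋ : (a ∷ p) * q ≋ scaleQ a q
  aq≋ = ≋-trans (*-congʳ {q} {a ∷ p} {a ∷ []} (∷-cong refl (pointwise λ i → above (suc i) (s≤s z≤n))))
    (const-mul a q)
Degree-* {a ∷ p} {q} {suc m} {n} (degree pₘ≢0 above) deg-q = Degree-addˡ
  (λ i m+n<i → trans (coeff-scale a q i)
    (trans (cong (a ℚ.*_) (above≡0 deg-q i (ℕ.≤-trans (s≤s (ℕ.m≤n+m n m)) m+n<i))) (ℚ.*-zeroʳ a)))
  (Degree-∷ (Degree-* {p} (degree pₘ≢0 λ i m<i → above (suc i) (s≤s m<i)) deg-q))

1-degree : Degree 1# 0
1-degree = degree ℚ.1≢0 λ { (suc i) _ → refl }

Degree-^ : ∀ {p n} k → Degree p n → Degree (p ^ k) (k ℕ.* n)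
Degree-^ zero    deg = 1-degree
Degree-^ (suc k) deg = Degree-* deg (Degree-^ k deg)

Degree-neg : ∀ {p n} → Degree p n → Degree (- p) n
Degree-neg {p} {n} (degree pₙ≢0 above) = degree
  (λ -pₙ≡0 → pₙ≢0 (ℚ.neg-injective (trans (sym (coeff-neg p n)) -pₙ≡0)))
  λ i n<i → trans (coeff-neg p i) (cong (ℚ.-_) (above i n<i))

-- Positive degree is essential: the constant 1 then lies below the leading term and cannot cancel
-- it.
Degree-1- : ∀ {p n} → Degree p (suc n) → Degree (1# - p) (suc n)
Degree-1- deg = Degree-addˡ (λ { (suc i) _ → refl }) (Degree-neg deg)

constant-or-degree : ∀ p → IsConstantQ p ⊎ ∃[ n ] Degree p (suc n)
constant-or-degree p with zero-or-degree p
... | inj₁ p≋0           = inj₁ λ i _ → at p≋0 i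
... | inj₂ (zero , deg)  = inj₁ (above≡0 deg)
... | inj₂ (suc n , deg) = inj₂ (n , deg)

-- Powers dividing a `k`-free polynomial.

powQ≡^ : ∀ p k → powQ p k ≡ p ^ k
powQ≡^ p zero    = refl
powQ≡^ p (suc k) = cong (p *_) (powQ≡^ p k)

∣⇒DividesQ : ∀ {p q} → p ∣ q → DividesQ p q
∣⇒DividesQ {p} (a , ap≋q) = a , at (≋-trans (mul-comm p a) ap≋q)

-- A divisor of least positive degree whose k-th power divides g is irreducible.
KFree⇒∤ : ∀ {k g} → KFree k g → ∀ n {p} → Degree p (suc n) → ¬ (p ^ k ∣ toQ g)
KFree⇒∤ {k} {g} kfree = <-rec _ step
  where
  step : ∀ n → (∀ {m} → m < n → ∀ {p} → Degree p (suc m) → ¬ (p ^ k ∣ toQ g)) →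
         ∀ {p} → Degree p (suc n) → ¬ (p ^ k ∣ toQ g)
  step n smaller {p} deg pᵏ∣g = kfree
    ( p , ((λ const → lead≢0 deg (const (suc n) (s≤s z≤n))) , irreducible)
    , subst (λ q → DividesQ q (toQ g)) (sym (powQ≡^ p k)) (∣⇒DividesQ pᵏ∣g))
    where
    irreducible : ∀ a b → mulQ a b ≈Q p → IsConstantQ a ⊎ IsConstantQ b
    irreducible a b ab≈p with constant-or-degree a | constant-or-degree b
    ... | inj₁ a-const  | _             = inj₁ a-const
    ... | inj₂ _        | inj₁ b-const  = inj₂ b-const
    ... | inj₂ (i , deg-a) | inj₂ (j , deg-b) =
      -- A non-constant `a` dividing `p` has `a ^ k` dividing `p ^ k`, hence `g`, while its degree
      -- is below that of `p`.
      contradiction (∣ʳ-trans (^-mono-∣ k a∣p) pᵏ∣g) (smaller i<n deg-a)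
      where
      a∣p : a ∣ p
      a∣p = b , ≋-trans (mul-comm b a) (pointwise ab≈p)
      -- The degrees of `a`, `b` and `p` are `suc i`, `suc j` and `suc n`; one successor has been
      -- cancelled.
      i+1+j≡n : i ℕ.+ suc j ≡ n
      i+1+j≡n = ℕ.suc-injective
        (Degree-unique (Degree-resp-≋ (pointwise ab≈p) (Degree-* deg-a deg-b)) deg)
      i<n : i < n
      i<n = subst (i <_) i+1+j≡n (ℕ.m<m+n i (s≤s z≤n))

-- Integers inside the rationals.

ι : ℤ → ℚ
ι a = a ℚ./ 1

-- `ι a` is normalised through a gcd, which does not compute for a variable `a`. Passing to
-- unnormalised fractions reduces the laws below to integer identities.
toℚᵘ-ι : ∀ a → ℚ.toℚᵘ (ι a) ℚᵘ.≃ a ℚᵘ./ 1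
toℚᵘ-ι a = ℚ.toℚᵘ-fromℚᵘ (a ℚᵘ./ 1)

ι-+ : ∀ a b → ι (a ℤ.+ b) ≡ ι a ℚ.+ ι b
ι-+ a b = ℚ.toℚᵘ-injective (begin
  ℚ.toℚᵘ (ι (a ℤ.+ b))              ≈⟨ toℚᵘ-ι (a ℤ.+ b) ⟩
  (a ℤ.+ b) ℚᵘ./ 1                  ≈⟨ ℚᵘ.*≡* (cong (ℤ._* ℤ.1ℤ) a+b≡a1+b1) ⟩
  (a ℚᵘ./ 1) ℚᵘ.+ (b ℚᵘ./ 1)        ≈⟨ ℚᵘ.+-cong (toℚᵘ-ι a) (toℚᵘ-ι b) ⟨
  ℚ.toℚᵘ (ι a) ℚᵘ.+ ℚ.toℚᵘ (ι b)    ≈⟨ ℚ.toℚᵘ-homo-+ (ι a) (ι b) ⟨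
  ℚ.toℚᵘ (ι a ℚ.+ ι b)              ∎)
  where
  open ℚᵘ.≃-Reasoning
  a+b≡a1+b1 : a ℤ.+ b ≡ a ℤ.* ℤ.1ℤ ℤ.+ b ℤ.* ℤ.1ℤ
  a+b≡a1+b1 = sym (cong₂ ℤ._+_ (ℤ.*-identityʳ a) (ℤ.*-identityʳ b))

ι-* : ∀ a b → ι (a ℤ.* b) ≡ ι a ℚ.* ι b
ι-* a b = ℚ.toℚᵘ-injective (begin
  ℚ.toℚᵘ (ι (a ℤ.* b))              ≈⟨ toℚᵘ-ι (a ℤ.* b) ⟩
  (a ℚᵘ./ 1) ℚᵘ.* (b ℚᵘ./ 1)        ≈⟨ ℚᵘ.*-cong (toℚᵘ-ι a) (toℚᵘ-ι b) ⟨
  ℚ.toℚᵘ (ι a) ℚᵘ.* ℚ.toℚᵘ (ι b)    ≈⟨ ℚ.toℚᵘ-homo-* (ι a) (ι b) ⟨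
  ℚ.toℚᵘ (ι a ℚ.* ι b)              ∎)
  where open ℚᵘ.≃-Reasoning

ι-neg : ∀ a → ι (ℤ.- a) ≡ ℚ.- ι a
ι-neg a = ℚ.toℚᵘ-injective (begin
  ℚ.toℚᵘ (ι (ℤ.- a))     ≈⟨ toℚᵘ-ι (ℤ.- a) ⟩
  ℚᵘ.- (a ℚᵘ./ 1)        ≈⟨ ℚᵘ.-‿cong (toℚᵘ-ι a) ⟨
  ℚᵘ.- ℚ.toℚᵘ (ι a)      ≈⟨ ℚ.toℚᵘ-homo‿- (ι a) ⟨
  ℚ.toℚᵘ (ℚ.- ι a)       ∎)
  where open ℚᵘ.≃-Reasoning

ι-injective : ∀ {a b} → ι a ≡ ι b → a ≡ b
ι-injective {a} {b} ιa≡ιb with ℚ.fromℚᵘ-injective {a ℚᵘ./ 1} {b ℚᵘ./ 1} ιa≡ιb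
... | ℚᵘ.*≡* eq = trans (sym (ℤ.*-identityʳ a)) (trans eq (ℤ.*-identityʳ b))

-- Integer polynomials inside the rational ones.

toQ-sub : ∀ p q → toQ (subZ p q) ≋ toQ p - toQ q
toQ-sub []      []      = ≋-refl
toQ-sub []      (b ∷ q) = ∷-cong (ι-neg b) (toQ-sub [] q)
toQ-sub (a ∷ p) []      = ≋-refl
toQ-sub (a ∷ p) (b ∷ q) =
  ∷-cong (trans (ι-+ a (ℤ.- b)) (cong (ι a ℚ.+_) (ι-neg b))) (toQ-sub p q)

-- With `h` the difference of `p` and `q`, this writes `q` as `p - h`, so that knowledge of a short
-- `h` becomes knowledge of `q`.
toQ-recover : ∀ p q → toQ q ≋ toQ p - toQ (subZ p q)
toQ-recover p q = ≋-sym (begin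
  toQ p - toQ (subZ p q)   ≈⟨ add-cong (≋-refl {toQ p}) (neg-cong (toQ-sub p q)) ⟩
  toQ p - (toQ p - toQ q)  ≈⟨ x-[x-y]≈y (toQ p) (toQ q) ⟩
  toQ q                    ∎)
  where open ≋-Reasoning

coeff-toQ : ∀ p i → coeffQ (toQ p) i ≡ ι (coeffZ p i)
coeff-toQ []      i       = refl
coeff-toQ (a ∷ p) zero    = refl
coeff-toQ (a ∷ p) (suc i) = coeff-toQ p i

IntegerQ : ℚ → Set
IntegerQ c = ∃[ a ] ι a ≡ c

-- The construction runs in the ring over ℚ, and this predicate records that it never leaves ℤ. It
-- concerns list entries, so `integral⇒toQ` yields propositional equality.
Integral : PolyQ → Set
Integral = All IntegerQ

integer-+ : ∀ {c d} → IntegerQ c → IntegerQ d → IntegerQ (c ℚ.+ d)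
integer-+ (a , refl) (b , refl) = a ℤ.+ b , ι-+ a b

integer-* : ∀ {c d} → IntegerQ c → IntegerQ d → IntegerQ (c ℚ.* d)
integer-* (a , refl) (b , refl) = a ℤ.* b , ι-* a b

integral-+ : ∀ {p q} → Integral p → Integral q → Integral (p + q)
integral-+ []        q         = q
integral-+ (a ∷ p)   []        = a ∷ p
integral-+ (a ∷ p)   (b ∷ q)   = integer-+ a b ∷ integral-+ p q

integral-scale : ∀ {c p} → IntegerQ c → Integral p → Integral (scaleQ c p)
integral-scale c []      = []
integral-scale c (a ∷ p) = integer-* c a ∷ integral-scale c p

integral-neg : ∀ {p} → Integral p → Integral (- p)
integral-neg []               = []
integral-neg ((a , refl) ∷ p) = (ℤ.- a , ι-neg a) ∷ integral-neg p

integral-* : ∀ {p q} → Integral p → Integral q → Integral (p * q)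
integral-* []      q = []
integral-* (a ∷ p) q = integral-+ (integral-scale a q) ((ℤ.0ℤ , refl) ∷ integral-* p q)

integral-1 : Integral 1#
integral-1 = (ℤ.1ℤ , refl) ∷ []

integral-^ : ∀ {p} k → Integral p → Integral (p ^ k)
integral-^ zero    p = integral-1
integral-^ (suc k) p = integral-* p (integral-^ k p)

integral⇒toQ : ∀ {p} → Integral p → ∃[ z ] toQ z ≡ p
integral⇒toQ []               = [] , refl
integral⇒toQ ((a , refl) ∷ p) with z , refl ← integral⇒toQ p = a ∷ z , refl

-- Monomials and polynomials of length less than 2.

mono : ℚ → ℕ → PolyQ
mono c zero    = c ∷ []
mono c (suc j) = 0ℚ ∷ mono c j

X : PolyQ
X = mono 1ℚ 1

X-degree : Degree X 1
X-degree = Degree-∷ 1-degree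

integral-mono : ∀ {c} j → IntegerQ c → Integral (mono c j)
integral-mono zero    c = c ∷ []
integral-mono (suc j) c = (ℤ.0ℤ , refl) ∷ integral-mono j c

neg-mono : ∀ c j → - mono c j ≡ mono (ℚ.- c) j
neg-mono c zero    = refl
neg-mono c (suc j) = cong (0ℚ ∷_) (neg-mono c j)

X*p≋0∷p : ∀ p → X * p ≋ (0ℚ ∷ p)
X*p≋0∷p p = ≋-trans (0∷-mul 1# p) (∷-cong refl (*-identityˡ p))

X^k∣mono : ∀ {k j} c → k ≤ j → X ^ k ∣ mono c j
X^k∣mono {zero}  {j}     c z≤n       = mono c j , *-identityʳ (mono c j)
X^k∣mono {suc k} {suc j} c (s≤s k≤j) = ∣ʳ-respʳ-≈ (X*p≋0∷p (mono c j))
  (∙-cong-∣ (∣ʳ-refl {X}) (X^k∣mono c k≤j))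

data IsSign : ℚ → Set where
  +1ℚ : IsSign 1ℚ
  -1ℚ : IsSign (ℚ.- 1ℚ)

neg-sign : ∀ {c} → IsSign c → IsSign (ℚ.- c)
neg-sign +1ℚ = -1ℚ
neg-sign -1ℚ = +1ℚ

-- The shifts that need a prepared divisor; a monomial of exponent at least `k` is divisible by
-- `X ^ k`.
signedMonomials : ℕ → List PolyQ
signedMonomials zero    = []
signedMonomials (suc k) = mono 1ℚ k ∷ mono (ℚ.- 1ℚ) k ∷ signedMonomials k

lookup-signed : ∀ {P : PolyQ → Set} {k j c} → All P (signedMonomials k) →
                j < k → IsSign c → P (mono c j)
lookup-signed {k = suc k} (p₊ ∷ p₋ ∷ ps) (s≤s j≤k) sign with ℕ.m≤n⇒m<n∨m≡n j≤k | sign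
... | inj₁ j<k  | _   = lookup-signed ps j<k sign
... | inj₂ refl | +1ℚ = p₊
... | inj₂ refl | -1ℚ = p₋

integral-signed : ∀ k → All Integral (signedMonomials k)
integral-signed zero    = []
integral-signed (suc k) =
  integral-mono k (ℤ.1ℤ , refl) ∷ integral-mono k (ℤ.-1ℤ , refl) ∷ integral-signed k

L≡0⇒≋0 : ∀ h → L h ≡ 0 → toQ h ≋ []
L≡0⇒≋0 []              _   = ≋-refl
L≡0⇒≋0 (ℤ.+ zero ∷ h)  L≡0 = ≋-trans (∷-cong refl (L≡0⇒≋0 h L≡0)) 0∷[]≋[]

-- Each non-zero coefficient contributes at least 1 to the length, so at most one occurs, and it is
-- 1 or -1.
L<2⇒monomial : ∀ h → L h < 2 →
  toQ h ≋ [] ⊎ ∃[ c ] ∃[ j ] (IsSign c × toQ h ≋ mono c j)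
L<2⇒monomial [] _ = inj₁ ≋-refl
L<2⇒monomial (ℤ.+ zero ∷ h) L<2 with L<2⇒monomial h L<2
... | inj₁ h≋0                  = inj₁ (≋-trans (∷-cong refl h≋0) 0∷[]≋[])
... | inj₂ (c , j , sign , h≋m) = inj₂ (c , suc j , sign , ∷-cong refl h≋m)
L<2⇒monomial (ℤ.+ 1 ∷ h) (s≤s (s≤s L≤0)) =
  inj₂ (1ℚ , 0 , +1ℚ , ∷-cong refl (L≡0⇒≋0 h (ℕ.n≤0⇒n≡0 L≤0)))
L<2⇒monomial (ℤ.-[1+ 0 ] ∷ h) (s≤s (s≤s L≤0)) =
  inj₂ (ℚ.- 1ℚ , 0 , -1ℚ , ∷-cong refl (L≡0⇒≋0 h (ℕ.n≤0⇒n≡0 L≤0)))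
L<2⇒monomial (ℤ.+ suc (suc _) ∷ h)    (s≤s (s≤s ()))
L<2⇒monomial (ℤ.-[1+ suc _ ] ∷ h) (s≤s (s≤s ()))

-- Imposing the divisibilities one shift at a time.

record Covered (k : ℕ) (f m t : PolyQ) : Set where
  constructor covered
  field
    {factor}   : PolyQ
    {deg-1}    : ℕ
    factor-deg : Degree factor (suc deg-1)
    -- The invariant behind `adjust-old`: a later step changes `f` by a multiple of `m ^ k`, hence
    -- of `factor ^ k`.
    factor∣m   : factor ∣ m
    power∣f+t  : factor ^ k ∣ f + t

record Solution (k : ℕ) (ts : List PolyQ) : Set where
  field
    f m        : PolyQ
    f-integral : Integral f
    m-integral : Integral m
    {deg-1}    : ℕ
    m-degree   : Degree m (suc deg-1)
    X∣m        : X ∣ m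
    -- The summand [] gives this the shape f + t that adjust-old preserves.
    X^k∣f      : X ^ k ∣ f + []
    covers     : All (Covered k f m) ts

solution : ∀ k {ts} → All Integral ts → Solution k ts
solution k [] = record
  { f = []
  ; m = X
  ; f-integral = []
  ; m-integral = integral-mono 1 (ℤ.1ℤ , refl)
  ; m-degree = X-degree
  ; X∣m = ∣ʳ-refl
  ; X^k∣f = _ ∣0
  ; covers = []
  }
solution k {t ∷ _} (t-integral ∷ ts-integral) = record
  { f = adjust k m f t
  ; m = (1# - m) * m
  -- `adjust` is an integer polynomial expression in `f`, `t` and `m`, so no denominators arise.
  ; f-integral = integral-+ (integral-* (integral-+ f-integral t-integral)
      (integral-^ k (integral-+ integral-1 (integral-neg (integral-^ k m-integral)))))
      (integral-neg t-integral)
  ; m-integral = integral-* (integral-+ integral-1 (integral-neg m-integral)) m-integral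
  ; m-degree = Degree-* (Degree-1- m-degree) m-degree
  ; X∣m = x∣ʳy⇒x∣ʳzy (1# - m) X∣m
  ; X^k∣f = adjust-old k m f t (^-mono-∣ k X∣m) X^k∣f
  -- The base for the head `t` is `1 - m`; the earlier bases divide the old `m` and so also the new
  -- one.
  ; covers = covered (Degree-1- m-degree) (x∣xy (1# - m) m) (adjust-new k m f t)
      ∷ All.map (λ { (covered deg p∣m pᵏ∣) →
          covered deg (x∣ʳy⇒x∣ʳzy (1# - m) p∣m) (adjust-old k m f t (^-mono-∣ k p∣m) pᵏ∣) })
        covers
  }
  where open Solution (solution k ts-integral)

-- The infinite family in a given degree.

∣-perturb : ∀ {x f w t} → x ∣ w → x ∣ f + t → x ∣ (f + w) + t
∣-perturb {x} {f} {w} {t} x∣w x∣f+t = ∣ʳ-respʳ-≈ (begin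
  (f + t) + w   ≈⟨ add-assoc f t w ⟩
  f + (t + w)   ≈⟨ add-cong (≋-refl {f}) (add-comm t w) ⟩
  f + (w + t)   ≈⟨ add-assoc f w t ⟨
  (f + w) + t   ∎) (∣-+ x∣f+t x∣w)
  where open ≋-Reasoning

∣-scale : ∀ c {x p} → x ∣ p → x ∣ scaleQ c p
∣-scale c {x} {p} x∣p = ∣ʳ-respʳ-≈ (const-mul c p) (x∣ʳy⇒x∣ʳzy (c ∷ []) x∣p)

coeff-beyond-length : ∀ p i → length p ≤ i → coeffQ p i ≡ 0ℚ
coeff-beyond-length []      i       _         = refl
coeff-beyond-length (_ ∷ p) (suc i) (s≤s p≤i) = coeff-beyond-length p i p≤i

-- The bound does two jobs: `n` is at least the degree of `m ^ k`, so a shift of that power reaches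
-- degree `n`, and at least the length of `f`, so `f` cannot disturb the coefficient at `n`.
module Family (k n : ℕ) (S : Solution k (signedMonomials k))
  (N₀≤n : length (Solution.f S) ℕ.+ k ℕ.* suc (Solution.deg-1 S) ≤ n) where

  open Solution S

  -- The exponent that brings `v` to degree exactly `n`; the truncated subtraction is genuine by
  -- `N₀≤n`.
  s : ℕ
  s = n ℕ.∸ k ℕ.* suc deg-1

  v : PolyQ
  v = X ^ s * m ^ k

  v-degree : Degree v n
  v-degree = subst (Degree v) eq (Degree-* (Degree-^ s X-degree) (Degree-^ k m-degree))
    where
    eq : s ℕ.* 1 ℕ.+ k ℕ.* suc deg-1 ≡ n
    eq = trans (cong (ℕ._+ k ℕ.* suc deg-1) (ℕ.*-identityʳ s))
      (ℕ.m∸n+n≡m (ℕ.≤-trans (ℕ.m≤n+m _ (length f)) N₀≤n))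

  -- Starting from 1 keeps every multiplier non-zero, so no member of the family drops in degree.
  c : ℕ → ℚ
  c i = ι (ℤ.+ suc i)

  c≢0 : ∀ i → c i ≢ 0ℚ
  c≢0 i cᵢ≡0 with () ← ι-injective {ℤ.+ suc i} {ℤ.0ℤ} cᵢ≡0

  FQ : ℕ → PolyQ
  FQ i = f + scaleQ (c i) v

  f-small : ∀ i → n ≤ i → coeffQ f i ≡ 0ℚ
  f-small i n≤i = coeff-beyond-length f i
    (ℕ.≤-trans (ℕ.m≤m+n (length f) _) (ℕ.≤-trans N₀≤n n≤i))

  FQ-degree : ∀ i → Degree (FQ i) n
  FQ-degree i = Degree-addˡ f-small (Degree-scale (c≢0 i) v-degree)

  FQ-lead : ∀ i → coeffQ (FQ i) n ≡ coeffQ v n ℚ.* c i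
  FQ-lead i = trans (coeff-add-zeroˡ f (scaleQ (c i) v) n (f-small n ℕ.≤-refl))
    (trans (coeff-scale (c i) v n) (ℚ.*-comm (c i) (coeffQ v n)))

  integer-FQ : ∀ i → ∃[ z ] toQ z ≡ FQ i
  integer-FQ i = integral⇒toQ (integral-+ f-integral (integral-scale (ℤ.+ suc i , refl)
    (integral-* (integral-^ s (integral-mono 1 (ℤ.1ℤ , refl))) (integral-^ k m-integral))))

  F : ℕ → PolyZ
  F i = proj₁ (integer-FQ i)

  toQ-F : ∀ i → toQ (F i) ≡ FQ i
  toQ-F i = proj₂ (integer-FQ i)

  coeff-F : ∀ i a → coeffQ (FQ i) a ≡ ι (coeffZ (F i) a)
  coeff-F i a = trans (cong (λ p → coeffQ p a) (sym (toQ-F i))) (coeff-toQ (F i) a)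

  -- The coefficient at `n` tells the members apart: it is the non-zero leading coefficient of `v`
  -- times `c i`.
  F-injective : ∀ i j → F i ≈Z F j → i ≡ j
  F-injective i j Fi≈Fj = ℕ.suc-injective (ℤ.+-injective (ι-injective
    (*ℚ-cancelˡ (lead≢0 v-degree) (begin
      coeffQ v n ℚ.* c i   ≡⟨ FQ-lead i ⟨
      coeffQ (FQ i) n      ≡⟨ coeff-F i n ⟩
      ι (coeffZ (F i) n)   ≡⟨ cong ι (Fi≈Fj n) ⟩
      ι (coeffZ (F j) n)   ≡⟨ coeff-F j n ⟨
      coeffQ (FQ j) n      ≡⟨ FQ-lead j ⟩
      coeffQ v n ℚ.* c j   ∎))))
    where open ≡-Reasoning

  F-degree : ∀ i → HasDegree (F i) n
  F-degree i =
    (λ Fₙ≡0 → lead≢0 (FQ-degree i) (trans (coeff-F i n) (cong ι Fₙ≡0))) ,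
    λ a n<a → ι-injective {b = ℤ.0ℤ} (trans (sym (coeff-F i a)) (above≡0 (FQ-degree i) a n<a))

  -- The term added to `f` is a multiple of `m ^ k`, hence of `p ^ k`.
  ∣-FQ : ∀ i {p t} → p ∣ m → p ^ k ∣ f + t → p ^ k ∣ FQ i + t
  ∣-FQ i p∣m = ∣-perturb {f = f} (∣-scale (c i) (x∣ʳy⇒x∣ʳzy (X ^ s) (^-mono-∣ k p∣m)))

  toQ-neighbour : ∀ i g → toQ g ≋ FQ i - toQ (subZ (F i) g)
  toQ-neighbour i g = subst (λ p → toQ g ≋ p - toQ (subZ (F i) g)) (toQ-F i) (toQ-recover (F i) g)

  -- For `j < k` the base prepared for this monomial works; for larger `j` the power `X ^ k` divides
  -- both summands.
  FQ+t-not-kfree : ∀ i {c j} → IsSign c →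
    ∃[ p ] ∃[ d ] (Degree p (suc d) × p ^ k ∣ FQ i + mono c j)
  FQ+t-not-kfree i {c} {j} sign with j ℕ.<? k
  ... | yes j<k with covered deg p∣m pᵏ∣ ← lookup-signed covers j<k sign =
    _ , _ , deg , ∣-FQ i p∣m pᵏ∣
  ... | no j≮k = X , 0 , X-degree ,
    ∣-+ (∣ʳ-respʳ-≈ (add-identityʳ (FQ i)) (∣-FQ i X∣m X^k∣f)) (X^k∣mono c (ℕ.≮⇒≥ j≮k))

  near⇒not-kfree : ∀ i g → L (subZ (F i) g) < 2 →
    ∃[ p ] ∃[ d ] (Degree p (suc d) × p ^ k ∣ toQ g)
  near⇒not-kfree i g L<2 with L<2⇒monomial (subZ (F i) g) L<2
  ... | inj₁ h≋0 = X , 0 , X-degree , ∣ʳ-respʳ-≈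
    (≋-sym (≋-trans (toQ-neighbour i g) (add-cong ≋-refl (neg-cong h≋0))))
    (∣-FQ i X∣m X^k∣f)
  -- Here `g` is `FQ i` minus the monomial, so the base belongs to the opposite sign.
  ... | inj₂ (c , j , sign , h≋m) with p , d , deg , pᵏ∣ ← FQ+t-not-kfree i {j = j} (neg-sign sign) =
    p , d , deg , ∣ʳ-respʳ-≈
      (≋-sym (≋-trans (toQ-neighbour i g)
        (add-cong (≋-refl {FQ i}) (subst (- toQ (subZ (F i) g) ≋_) (neg-mono c j) (neg-cong h≋m)))))
      pᵏ∣

  -- The base obtained for a near `g` may be reducible; `KFree⇒∤` covers every base of positive
  -- degree.
  far-from-kfree : ∀ i g → KFree k g → 2 ≤ L (subZ (F i) g)
  far-from-kfree i g kfree = ℕ.≮⇒≥ λ L<2 →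
    let _ , d , deg , pᵏ∣g = near⇒not-kfree i g L<2 in KFree⇒∤ {k} {g} kfree d deg pᵏ∣g

theorem1p3 : (k : ℕ) → 2 ≤ k →
    Σ ℕ λ N₀ → (n : ℕ) → N₀ ≤ n →
    Σ (ℕ → PolyZ) λ F →
    ((i j : ℕ) → F i ≈Z F j → i ≡ j) ×
    ((m : ℕ) → HasDegree (F m) n ×
    ((g : PolyZ) → KFree k g → 2 ≤ L (subZ (F m) g)))
-- The bound depends on `k` alone and is computed by the recursion in `solution`.
theorem1p3 k _ = length f ℕ.+ k ℕ.* suc deg-1 , λ n N₀≤n →
  let open Family k n S N₀≤n in
  F , F-injective , λ i → F-degree i , far-from-kfree i
  where
  S : Solution k (signedMonomials k)
  S = solution k (integral-signed k)
  open Solution S
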